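{- Let $\tau = \frac{4-\sqrt{7}}{9}$. For every $\epsilon > 0$ there exist a positive integer $n$ and simple graphs $G_1, G_2, G_3$ on a common set of $n$ vertices that have no rainbow triangle and satisfy $|E(G_i)| > \left(\frac{1+\tau^2}{4} - \epsilon\right) n^2$ for every $1 \le i \le 3$.
   Context: All graphs are finite and simple. For three graphs $G_1, G_2, G_3$ on a common vertex set $V$, a rainbow triangle consists of three distinct vertices $v_1, v_2, v_3 \in V$ such that $v_1v_2 \in E(G_1)$, $v_2v_3 \in E(G_2)$ and $v_3v_1 \in E(G_3)$. -}

module Defs where

open import Data.Fin using (Fin) renaming (_<?_ to _<ᶠ?_)
open import Data.Fin.Patterns using (0F; 1F; 2F)
open import Data.Integer.Base as ℤ using (+_; +[1+_])
import Data.Integer.Properties as ℤ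
open import Data.Integer.Solver using () renaming (module +-*-Solver to ℤ-Solver)
open import Data.List.Base using (List; length; filter; allFin; cartesianProduct)
open import Data.Nat.Base as ℕ using (ℕ; zero; suc)
import Data.Nat.Properties as ℕ
open import Data.Nat.Solver using (module +-*-Solver)
open import Data.Product using (∃-syntax; _×_; _,_; proj₁; proj₂; uncurry)
open import Data.Rational.Base as ℚ using (ℚ; 0ℚ; 1ℚ; ∣_∣)
import Data.Rational.Properties as ℚ
open import Data.Rational.Solver using () renaming (module +-*-Solver to ℚ-Solver)
open import Data.Rational.Unnormalised.Base as ℚᵘ using (mkℚᵘ)
import Data.Rational.Unnormalised.Properties as ℚᵘ
open import Data.Sum using (inj₁; inj₂)
open import Level using (0ℓ)
open import Relation.Binary using (Rel; Symmetric; Irreflexive; Decidable)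
open import Relation.Binary.PropositionalEquality
  using (_≡_; _≢_; refl; sym; trans; cong; cong₂; subst; subst₂)
open import Relation.Nullary using (¬_; yes; no)
open import Relation.Nullary.Decidable using (_×-dec_)

record Graph (n : ℕ) : Set₁ where
  field
    Adj    : Rel (Fin n) 0ℓ
    adj?   : Decidable Adj
    symm   : Symmetric Adj
    irrefl : Irreflexive _≡_ Adj

open Graph public

-- The edge {u , v} is listed once, as the pair with u < v.
edges : ∀ {n} → Graph n → List (Fin n × Fin n)
edges {n} G =
  filter (uncurry λ u v → (u <ᶠ? v) ×-dec adj? G u v)
         (cartesianProduct (allFin n) (allFin n))

∣E_∣ : ∀ {n} → Graph n → ℕ
∣E G ∣ = length (edges G)

RainbowTriangle : ∀ {n} → (Fin 3 → Graph n) → Set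
RainbowTriangle G =
  ∃[ v₁ ] ∃[ v₂ ] ∃[ v₃ ]
    (v₁ ≢ v₂ × v₂ ≢ v₃ × v₃ ≢ v₁) ×
    Adj (G 0F) v₁ v₂ × Adj (G 1F) v₂ v₃ × Adj (G 2F) v₃ v₁

IsCauchy : (ℕ → ℚ) → Set
IsCauchy x = ∀ ε → 0ℚ ℚ.< ε →
  ∃[ N ] (∀ m n → N ℕ.≤ m → N ℕ.≤ n → ∣ x m ℚ.- x n ∣ ℚ.< ε)

-- Reals are Cauchy sequences of rationals taken up to _≈_, not up to _≡_.
record ℝ : Set where
  constructor mkℝ
  field
    seq    : ℕ → ℚ
    cauchy : IsCauchy seq

open ℝ public

infix 4 _≈_ _<_

_≈_ : ℝ → ℝ → Set
x ≈ y = ∀ ε → 0ℚ ℚ.< ε →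
  ∃[ N ] (∀ n → N ℕ.≤ n → ∣ seq x n ℚ.- seq y n ∣ ℚ.< ε)

-- A uniform rational gap is needed: pointwise _<_ is not invariant under _≈_.
_<_ : ℝ → ℝ → Set
x < y = ∃[ δ ] (0ℚ ℚ.< δ ×
  ∃[ N ] (∀ n → N ℕ.≤ n → seq x n ℚ.+ δ ℚ.< seq y n))

private
  split : ∀ ε → 0ℚ ℚ.< ε → ∀ B → 0ℚ ℚ.< B →
          ∃[ δ ] (0ℚ ℚ.< δ × δ ℚ.* B ≡ ε)
  split ε ε>0 B B>0 = ε ℚ.* 1/B , pos ,
    trans (ℚ.*-assoc ε 1/B B)
      (trans (cong (ε ℚ.*_) (ℚ.*-inverseˡ B)) (ℚ.*-identityʳ ε))
    where
    instance
      _ = ℚ.positive B>0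
      _ = ℚ.pos⇒nonZero B
    1/B = ℚ.1/ B
    instance
      _ = ℚ.1/pos⇒pos B
    pos : 0ℚ ℚ.< ε ℚ.* 1/B
    pos = subst (ℚ._< ε ℚ.* 1/B) (ℚ.*-zeroˡ 1/B) (ℚ.*-monoˡ-<-pos 1/B ε>0)

  0<1 : 0ℚ ℚ.< 1ℚ
  0<1 = ℚ.*<* (ℤ.+<+ (ℕ.s≤s ℕ.z≤n))

  bounded : ∀ {x} → IsCauchy x →
            ∃[ B ] (0ℚ ℚ.< B × ∃[ N ] (∀ n → N ℕ.≤ n → ∣ x n ∣ ℚ.< B))
  bounded {x} cx with cx 1ℚ 0<1
  ... | N , h = 1ℚ ℚ.+ ∣ x N ∣ ,
    ℚ.+-mono-<-≤ 0<1 (ℚ.0≤∣p∣ (x N)) ,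
    N , λ n N≤n → ℚ.≤-<-trans
      (subst (ℚ._≤ ∣ x n ℚ.- x N ∣ ℚ.+ ∣ x N ∣)
             (cong ∣_∣ (solve 2 (λ a b → (a :- b) :+ b := a) refl (x n) (x N)))
             (ℚ.∣p+q∣≤∣p∣+∣q∣ (x n ℚ.- x N) (x N)))
      (ℚ.+-monoˡ-< ∣ x N ∣ (h n N N≤n ℕ.≤-refl))
    where open ℚ-Solver

  const-cauchy : ∀ q → IsCauchy (λ _ → q)
  const-cauchy q ε ε>0 = 0 , λ _ _ _ _ →
    subst (λ t → ∣ t ∣ ℚ.< ε) (sym (ℚ.+-inverseʳ q)) ε>0

  neg-cauchy : ∀ {x} → IsCauchy x → IsCauchy (λ n → ℚ.- x n)
  neg-cauchy {x} cx ε ε>0 with cx ε ε>0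
  ... | N , h = N , λ m n N≤m N≤n →
    subst (ℚ._< ε)
      (trans (sym (ℚ.∣-p∣≡∣p∣ (x m ℚ.- x n)))
             (cong ∣_∣ (ℚ.neg-distrib-+ (x m) (ℚ.- x n))))
      (h m n N≤m N≤n)

  two : ℚ
  two = 1ℚ ℚ.+ 1ℚ

  0<2 : 0ℚ ℚ.< two
  0<2 = ℚ.*<* (ℤ.+<+ (ℕ.s≤s ℕ.z≤n))

  +-cauchy : ∀ {x y} → IsCauchy x → IsCauchy y → IsCauchy (λ n → x n ℚ.+ y n)
  +-cauchy {x} {y} cx cy ε ε>0 with split ε ε>0 two 0<2
  ... | δ , δ>0 , δ2≡ε with cx δ δ>0 | cy δ δ>0
  ... | M , hx | N , hy = M ℕ.⊔ N , λ m n l₁ l₂ →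
    subst₂ ℚ._<_
      refl
      (trans (solve 1 (λ d → d :+ d := d :* (con 1ℚ :+ con 1ℚ)) refl δ) δ2≡ε)
      (ℚ.≤-<-trans
        (subst (ℚ._≤ ∣ x m ℚ.- x n ∣ ℚ.+ ∣ y m ℚ.- y n ∣)
          (cong ∣_∣ (solve 4 (λ a b c d → (a :- b) :+ (c :- d) := (a :+ c) :- (b :+ d))
                      refl (x m) (x n) (y m) (y n)))
          (ℚ.∣p+q∣≤∣p∣+∣q∣ (x m ℚ.- x n) (y m ℚ.- y n)))
        (ℚ.+-mono-<
          (hx m n (ℕ.m⊔n≤o⇒m≤o M N l₁) (ℕ.m⊔n≤o⇒m≤o M N l₂))
          (hy m n (ℕ.m⊔n≤o⇒n≤o M N l₁) (ℕ.m⊔n≤o⇒n≤o M N l₂))))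
    where open ℚ-Solver

  ∣*∣-bound : ∀ p q {a b} → ∣ p ∣ ℚ.< a → ∣ q ∣ ℚ.< b → 0ℚ ℚ.< b →
              ∣ p ℚ.* q ∣ ℚ.< a ℚ.* b
  ∣*∣-bound p q {a} {b} p<a q<b b>0 = begin-strict
    ∣ p ℚ.* q ∣        ≡⟨ ℚ.∣p*q∣≡∣p∣*∣q∣ p q ⟩
    ∣ p ∣ ℚ.* ∣ q ∣    ≤⟨ ℚ.*-monoˡ-≤-nonNeg ∣ p ∣ {{ℚ.∣-∣-nonNeg p}} (ℚ.<⇒≤ q<b) ⟩
    ∣ p ∣ ℚ.* b        <⟨ ℚ.*-monoˡ-<-pos b {{ℚ.positive b>0}} p<a ⟩
    a ℚ.* b            ∎
    where open ℚ.≤-Reasoning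

  *-difference : ∀ a b c d →
    a ℚ.* c ℚ.- b ℚ.* d ≡ (c ℚ.- d) ℚ.* a ℚ.+ (a ℚ.- b) ℚ.* d
  *-difference = solve 4
    (λ a b c d → a :* c :- b :* d := (c :- d) :* a :+ (a :- b) :* d) refl
    where open ℚ-Solver

  *-close : ∀ {δ A B} p p′ q q′ → 0ℚ ℚ.< A → 0ℚ ℚ.< B →
            ∣ p ∣ ℚ.< A → ∣ q′ ∣ ℚ.< B →
            ∣ p ℚ.- p′ ∣ ℚ.< δ → ∣ q ℚ.- q′ ∣ ℚ.< δ →
            ∣ p ℚ.* q ℚ.- p′ ℚ.* q′ ∣ ℚ.< δ ℚ.* (A ℚ.+ B)
  *-close {δ} {A} {B} p p′ q q′ A>0 B>0 p<A q′<B pp′ qq′ = begin-strict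
    ∣ p ℚ.* q ℚ.- p′ ℚ.* q′ ∣
      ≡⟨ cong ∣_∣ (*-difference p p′ q q′) ⟩
    ∣ (q ℚ.- q′) ℚ.* p ℚ.+ (p ℚ.- p′) ℚ.* q′ ∣
      ≤⟨ ℚ.∣p+q∣≤∣p∣+∣q∣ ((q ℚ.- q′) ℚ.* p) ((p ℚ.- p′) ℚ.* q′) ⟩
    ∣ (q ℚ.- q′) ℚ.* p ∣ ℚ.+ ∣ (p ℚ.- p′) ℚ.* q′ ∣
      <⟨ ℚ.+-mono-< (∣*∣-bound (q ℚ.- q′) p qq′ p<A A>0)
                    (∣*∣-bound (p ℚ.- p′) q′ pp′ q′<B B>0) ⟩
    δ ℚ.* A ℚ.+ δ ℚ.* B
      ≡⟨ sym (ℚ.*-distribˡ-+ δ A B) ⟩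
    δ ℚ.* (A ℚ.+ B) ∎
    where open ℚ.≤-Reasoning

  *-cauchy : ∀ {x y} → IsCauchy x → IsCauchy y → IsCauchy (λ n → x n ℚ.* y n)
  *-cauchy {x} {y} cx cy ε ε>0 = M ℕ.⊔ N ℕ.⊔ (K ℕ.⊔ L) , close
    where
    bx = bounded cx
    by = bounded cy
    A = proj₁ bx
    B = proj₁ by
    A>0 : 0ℚ ℚ.< A
    A>0 = proj₁ (proj₂ bx)
    B>0 : 0ℚ ℚ.< B
    B>0 = proj₁ (proj₂ by)
    M = proj₁ (proj₂ (proj₂ bx))
    N = proj₁ (proj₂ (proj₂ by))
    sp = split ε ε>0 (A ℚ.+ B) (ℚ.+-mono-< {0ℚ} {A} {0ℚ} {B} A>0 B>0)
    δ = proj₁ sp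
    nx = cx δ (proj₁ (proj₂ sp))
    ny = cy δ (proj₁ (proj₂ sp))
    K = proj₁ nx
    L = proj₁ ny
    close : ∀ m n → M ℕ.⊔ N ℕ.⊔ (K ℕ.⊔ L) ℕ.≤ m → M ℕ.⊔ N ℕ.⊔ (K ℕ.⊔ L) ℕ.≤ n →
            ∣ x m ℚ.* y m ℚ.- x n ℚ.* y n ∣ ℚ.< ε
    close m n l₁ l₂ =
      subst (∣ x m ℚ.* y m ℚ.- x n ℚ.* y n ∣ ℚ.<_) (proj₂ (proj₂ sp))
        (*-close (x m) (x n) (y m) (y n) A>0 B>0
          (proj₂ (proj₂ (proj₂ bx)) m (ℕ.m⊔n≤o⇒m≤o M N MN₁))
          (proj₂ (proj₂ (proj₂ by)) n (ℕ.m⊔n≤o⇒n≤o M N MN₂))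
          (proj₂ nx m n (ℕ.m⊔n≤o⇒m≤o K L KL₁) (ℕ.m⊔n≤o⇒m≤o K L KL₂))
          (proj₂ ny m n (ℕ.m⊔n≤o⇒n≤o K L KL₁) (ℕ.m⊔n≤o⇒n≤o K L KL₂)))
      where
      MN₁ = ℕ.m⊔n≤o⇒m≤o (M ℕ.⊔ N) (K ℕ.⊔ L) l₁
      KL₁ = ℕ.m⊔n≤o⇒n≤o (M ℕ.⊔ N) (K ℕ.⊔ L) l₁
      MN₂ = ℕ.m⊔n≤o⇒m≤o (M ℕ.⊔ N) (K ℕ.⊔ L) l₂
      KL₂ = ℕ.m⊔n≤o⇒n≤o (M ℕ.⊔ N) (K ℕ.⊔ L) l₂

infix  8 -_
infixl 7 _*_ _÷_
infixl 6 _+_ _-_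

fromℚ : ℚ → ℝ
fromℚ q = mkℝ (λ _ → q) (const-cauchy q)

fromℕ : ℕ → ℝ
fromℕ n = fromℚ (+ n ℚ./ 1)

-_ : ℝ → ℝ
- x = mkℝ (λ n → ℚ.- seq x n) (neg-cauchy {seq x} (cauchy x))

_+_ _-_ _*_ : ℝ → ℝ → ℝ
x + y = mkℝ (λ n → seq x n ℚ.+ seq y n) (+-cauchy {seq x} {seq y} (cauchy x) (cauchy y))
x - y = x + (- y)
x * y = mkℝ (λ n → seq x n ℚ.* seq y n) (*-cauchy {seq x} {seq y} (cauchy x) (cauchy y))

_÷_ : ℝ → (d : ℕ) → .{{ℕ.NonZero d}} → ℝ
x ÷ d = x * fromℚ (+ 1 ℚ./ d)

⌊√_⌋ : ℕ → ℕ
⌊√ zero ⌋ = 0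
⌊√ suc m ⌋ with suc ⌊√ m ⌋ ℕ.* suc ⌊√ m ⌋ ℕ.≤? suc m
... | yes _ = suc ⌊√ m ⌋
... | no  _ = ⌊√ m ⌋

⌊√⌋-lower : ∀ m → ⌊√ m ⌋ ℕ.* ⌊√ m ⌋ ℕ.≤ m
⌊√⌋-lower zero = ℕ.z≤n
⌊√⌋-lower (suc m) with suc ⌊√ m ⌋ ℕ.* suc ⌊√ m ⌋ ℕ.≤? suc m
... | yes p = p
... | no  _ = ℕ.m≤n⇒m≤1+n (⌊√⌋-lower m)

⌊√⌋-upper : ∀ m → m ℕ.< suc ⌊√ m ⌋ ℕ.* suc ⌊√ m ⌋
⌊√⌋-upper zero = ℕ.s≤s ℕ.z≤n
⌊√⌋-upper (suc m) with suc ⌊√ m ⌋ ℕ.* suc ⌊√ m ⌋ ℕ.≤? suc m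
... | yes _ = ℕ.≤-<-trans (⌊√⌋-upper m)
                (ℕ.*-mono-< (ℕ.n<1+n (suc ⌊√ m ⌋)) (ℕ.n<1+n (suc ⌊√ m ⌋)))
... | no ¬p = ℕ.≰⇒> ¬p

-- ⌊ (n+1)√d ⌋ / (n+1), the truncation of √d to a multiple of 1/(n+1)
√num : ℕ → ℕ → ℕ
√num d n = ⌊√ d ℕ.* (suc n ℕ.* suc n) ⌋

√seq : ℕ → ℕ → ℚ
√seq d n = + √num d n ℚ./ suc n

unit : ℕ → ℚ
unit n = + 1 ℚ./ suc n

-- the truncation plus 1/(n+1), an upper bound for √d
√sup : ℕ → ℕ → ℚ
√sup d n = + suc (√num d n) ℚ./ suc n

√sup≡ : ∀ d n → √sup d n ≡ √seq d n ℚ.+ unit n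
√sup≡ d n = ℚ.toℚᵘ-injective (begin
    ℚ.toℚᵘ (√sup d n)
      ≈⟨ ℚ.toℚᵘ-fromℚᵘ (mkℚᵘ (+ suc a) n) ⟩
    mkℚᵘ (+ suc a) n
      ≈⟨ ℚᵘ.*≡* (solve 2 (λ a s → (con (+ 1) :+ a) :* (s :* s)
                            := (a :* s :+ con (+ 1) :* s) :* s) refl (+ a) (+ suc n)) ⟩
    mkℚᵘ (+ a) n ℚᵘ.+ mkℚᵘ (+ 1) n
      ≈⟨ ℚᵘ.≃-sym (ℚᵘ.+-cong (ℚ.toℚᵘ-fromℚᵘ (mkℚᵘ (+ a) n))
                             (ℚ.toℚᵘ-fromℚᵘ (mkℚᵘ (+ 1) n))) ⟩
    ℚ.toℚᵘ (√seq d n) ℚᵘ.+ ℚ.toℚᵘ (unit n)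
      ≈⟨ ℚᵘ.≃-sym (ℚ.toℚᵘ-homo-+ (√seq d n) (unit n)) ⟩
    ℚ.toℚᵘ (√seq d n ℚ.+ unit n) ∎)
  where
  a = √num d n
  open ℤ-Solver
  open import Relation.Binary.Reasoning.Setoid ℚᵘ.≃-setoid

sq-cancel-< : ∀ a b → a ℕ.* a ℕ.< b ℕ.* b → a ℕ.< b
sq-cancel-< a b h with ℕ.<-≤-connex a b
... | inj₁ a<b = a<b
... | inj₂ b≤a with () ← ℕ.<⇒≱ h (ℕ.*-mono-≤ b≤a b≤a)

√seq<√sup : ∀ d m n → √seq d m ℚ.< √sup d n
√seq<√sup d m n = ℚ.toℚᵘ-cancel-<
  (ℚᵘ.<-respˡ-≃ (ℚᵘ.≃-sym (ℚ.toℚᵘ-fromℚᵘ (mkℚᵘ (+ a) m)))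
  (ℚᵘ.<-respʳ-≃ (ℚᵘ.≃-sym (ℚ.toℚᵘ-fromℚᵘ (mkℚᵘ (+ suc b) n)))
  (ℚᵘ.*<* (subst₂ ℤ._<_ (ℤ.pos-* a (suc n)) (ℤ.pos-* (suc b) (suc m))
    (ℤ.+<+ (sq-cancel-< (a ℕ.* suc n) (suc b ℕ.* suc m) (begin-strict
      (a ℕ.* suc n) ℕ.* (a ℕ.* suc n)
        ≡⟨ solve 2 (λ a s → (a :* s) :* (a :* s) := (a :* a) :* (s :* s)) refl a (suc n) ⟩
      (a ℕ.* a) ℕ.* (suc n ℕ.* suc n)
        ≤⟨ ℕ.*-monoˡ-≤ (suc n ℕ.* suc n) (⌊√⌋-lower (d ℕ.* (suc m ℕ.* suc m))) ⟩
      (d ℕ.* (suc m ℕ.* suc m)) ℕ.* (suc n ℕ.* suc n)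
        ≡⟨ solve 3 (λ d s t → (d :* s) :* t := (d :* t) :* s) refl
             d (suc m ℕ.* suc m) (suc n ℕ.* suc n) ⟩
      (d ℕ.* (suc n ℕ.* suc n)) ℕ.* (suc m ℕ.* suc m)
        <⟨ ℕ.*-monoˡ-< (suc m ℕ.* suc m) (⌊√⌋-upper (d ℕ.* (suc n ℕ.* suc n))) ⟩
      (suc b ℕ.* suc b) ℕ.* (suc m ℕ.* suc m)
        ≡⟨ solve 2 (λ b s → (b :* b) :* (s :* s) := (b :* s) :* (b :* s)) refl
             (suc b) (suc m) ⟩
      (suc b ℕ.* suc m) ℕ.* (suc b ℕ.* suc m) ∎)))))))
  where
  a = √num d m
  b = √num d n
  open +-*-Solver
  open ℕ.≤-Reasoning

unit≤ : ∀ ε → 0ℚ ℚ.< ε → ∃[ N ] (∀ n → N ℕ.≤ n → unit n ℚ.≤ ε)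
unit≤ ε@(ℚ.mkℚ +[1+ p ] q _) ε>0 = q , λ n q≤n → ℚ.toℚᵘ-cancel-≤
  (ℚᵘ.≤-respˡ-≃ (ℚᵘ.≃-sym (ℚ.toℚᵘ-fromℚᵘ (mkℚᵘ (+ 1) n)))
    (ℚᵘ.*≤* (ℤ.+≤+ (ℕ.*-mono-≤ (ℕ.s≤s (ℕ.z≤n {p})) (ℕ.s≤s q≤n)))))
unit≤ (ℚ.mkℚ (+ 0) q _) (ℚ.*<* (ℤ.+<+ ()))
unit≤ (ℚ.mkℚ (ℤ.-[1+ p ]) q _) (ℚ.*<* ())

∣-∣< : ∀ p q {ε} → p ℚ.< q ℚ.+ ε → q ℚ.< p ℚ.+ ε → ∣ p ℚ.- q ∣ ℚ.< ε
∣-∣< p q {ε} p< q< with ℚ.∣p∣≡p∨∣p∣≡-p (p ℚ.- q)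
... | inj₁ eq = subst₂ ℚ._<_ (sym eq)
      (solve 2 (λ q e → (q :+ e) :- q := e) refl q ε)
      (ℚ.+-monoˡ-< (ℚ.- q) p<)
  where open ℚ-Solver
... | inj₂ eq = subst₂ ℚ._<_
      (trans (solve 2 (λ p q → q :- p := :- (p :- q)) refl p q) (sym eq))
      (solve 2 (λ p e → (p :+ e) :- p := e) refl p ε)
      (ℚ.+-monoˡ-< (ℚ.- p) q<)
  where open ℚ-Solver

√seq-cauchy : ∀ d → IsCauchy (√seq d)
√seq-cauchy d ε ε>0 with unit≤ ε ε>0
... | N , h = N , λ m n N≤m N≤n → ∣-∣< (√seq d m) (√seq d n)
    (step m n (h n N≤n)) (step n m (h m N≤m))
  where
  step : ∀ m n → unit n ℚ.≤ ε → √seq d m ℚ.< √seq d n ℚ.+ ε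
  step m n u≤ε = ℚ.<-≤-trans
    (subst (√seq d m ℚ.<_) (√sup≡ d n) (√seq<√sup d m n))
    (ℚ.+-monoʳ-≤ (√seq d n) u≤ε)

√ : ℕ → ℝ
√ d = mkℝ (√seq d) (√seq-cauchy d)

√seq²≤ : ∀ d n → √seq d n ℚ.* √seq d n ℚ.≤ + d ℚ./ 1
√seq²≤ d n = ℚ.toℚᵘ-cancel-≤ (begin
  ℚ.toℚᵘ (√seq d n ℚ.* √seq d n)
    ≃⟨ ℚ.toℚᵘ-homo-* (√seq d n) (√seq d n) ⟩
  ℚ.toℚᵘ (√seq d n) ℚᵘ.* ℚ.toℚᵘ (√seq d n)
    ≃⟨ ℚᵘ.*-cong (ℚ.toℚᵘ-fromℚᵘ (mkℚᵘ (+ a) n)) (ℚ.toℚᵘ-fromℚᵘ (mkℚᵘ (+ a) n)) ⟩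
  mkℚᵘ (+ a) n ℚᵘ.* mkℚᵘ (+ a) n
    ≤⟨ ℚᵘ.*≤* (subst₂ ℤ._≤_
         (trans (ℤ.pos-* a a) (sym (ℤ.*-identityʳ (+ a ℤ.* + a))))
         (ℤ.pos-* d (suc n ℕ.* suc n))
         (ℤ.+≤+ (⌊√⌋-lower (d ℕ.* (suc n ℕ.* suc n))))) ⟩
  mkℚᵘ (+ d) 0
    ≃⟨ ℚᵘ.≃-sym (ℚ.toℚᵘ-fromℚᵘ (mkℚᵘ (+ d) 0)) ⟩
  ℚ.toℚᵘ (+ d ℚ./ 1) ∎)
  where
  a = √num d n
  open ℚᵘ.≤-Reasoning

<√sup² : ∀ d n → + d ℚ./ 1 ℚ.< √sup d n ℚ.* √sup d n
<√sup² d n = ℚ.toℚᵘ-cancel-< (begin-strict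
  ℚ.toℚᵘ (+ d ℚ./ 1)
    ≃⟨ ℚ.toℚᵘ-fromℚᵘ (mkℚᵘ (+ d) 0) ⟩
  mkℚᵘ (+ d) 0
    <⟨ ℚᵘ.*<* (subst₂ ℤ._<_
         (ℤ.pos-* d (suc n ℕ.* suc n))
         (trans (ℤ.pos-* a a) (sym (ℤ.*-identityʳ (+ a ℤ.* + a))))
         (ℤ.+<+ (⌊√⌋-upper (d ℕ.* (suc n ℕ.* suc n))))) ⟩
  mkℚᵘ (+ a) n ℚᵘ.* mkℚᵘ (+ a) n
    ≃⟨ ℚᵘ.≃-sym (ℚᵘ.*-cong (ℚ.toℚᵘ-fromℚᵘ (mkℚᵘ (+ a) n)) (ℚ.toℚᵘ-fromℚᵘ (mkℚᵘ (+ a) n))) ⟩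
  ℚ.toℚᵘ (√sup d n) ℚᵘ.* ℚ.toℚᵘ (√sup d n)
    ≃⟨ ℚᵘ.≃-sym (ℚ.toℚᵘ-homo-* (√sup d n) (√sup d n)) ⟩
  ℚ.toℚᵘ (√sup d n ℚ.* √sup d n) ∎)
  where
  a = suc (√num d n)
  open ℚᵘ.≤-Reasoning

unit-nonNeg : ∀ n → 0ℚ ℚ.≤ unit n
unit-nonNeg n = ℚ.toℚᵘ-cancel-≤
  (ℚᵘ.≤-respʳ-≃ (ℚᵘ.≃-sym (ℚ.toℚᵘ-fromℚᵘ (mkℚᵘ (+ 1) n)))
    (ℚᵘ.*≤* (ℤ.+≤+ ℕ.z≤n)))

unit≤1 : ∀ n → unit n ℚ.≤ 1ℚ
unit≤1 n = ℚ.toℚᵘ-cancel-≤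
  (ℚᵘ.≤-respˡ-≃ (ℚᵘ.≃-sym (ℚ.toℚᵘ-fromℚᵘ (mkℚᵘ (+ 1) n)))
    (ℚᵘ.*≤* (ℤ.+≤+ (ℕ.s≤s ℕ.z≤n))))

expand-sq : ∀ s u → (s ℚ.+ u) ℚ.* (s ℚ.+ u) ≡ s ℚ.* s ℚ.+ u ℚ.* (s ℚ.+ s ℚ.+ u)
expand-sq = solve 2 (λ s u → (s :+ u) :* (s :+ u) := s :* s :+ u :* (s :+ s :+ u)) refl
  where open ℚ-Solver

√-square : ∀ d → √ d * √ d ≈ fromℕ d
√-square d ε ε>0 = proj₁ small , λ n N≤n →
  ∣-∣< (s n ℚ.* s n) D (below n) (above n (proj₂ small n N≤n))
  where
  D = + d ℚ./ 1
  s = √seq d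
  S = √sup d 0
  C = S ℚ.+ S ℚ.+ 1ℚ
  S>0 : 0ℚ ℚ.< S
  S>0 = ℚ.toℚᵘ-cancel-<
    (ℚᵘ.<-respʳ-≃ (ℚᵘ.≃-sym (ℚ.toℚᵘ-fromℚᵘ (mkℚᵘ (+ suc (√num d 0)) 0)))
      (ℚᵘ.*<* (ℤ.+<+ (ℕ.s≤s ℕ.z≤n))))
  C>0 : 0ℚ ℚ.< C
  C>0 = ℚ.+-mono-< {0ℚ} {S ℚ.+ S} {0ℚ} {1ℚ} (ℚ.+-mono-< {0ℚ} {S} {0ℚ} {S} S>0 S>0) 0<1
  instance
    _ = ℚ.nonNegative (ℚ.<⇒≤ C>0)
  sp = split ε ε>0 C C>0
  δ = proj₁ sp
  small = unit≤ δ (proj₁ (proj₂ sp))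
  open ℚ.≤-Reasoning
  below : ∀ n → s n ℚ.* s n ℚ.< D ℚ.+ ε
  below n = begin-strict
    s n ℚ.* s n  ≤⟨ √seq²≤ d n ⟩
    D            ≡⟨ sym (ℚ.+-identityʳ D) ⟩
    D ℚ.+ 0ℚ     <⟨ ℚ.+-monoʳ-< D ε>0 ⟩
    D ℚ.+ ε      ∎
  s≤S : ∀ n → s n ℚ.≤ S
  s≤S n = ℚ.<⇒≤ (√seq<√sup d n 0)
  above : ∀ n → unit n ℚ.≤ δ → D ℚ.< s n ℚ.* s n ℚ.+ ε
  above n u≤δ = begin-strict
    D
      <⟨ <√sup² d n ⟩
    √sup d n ℚ.* √sup d n
      ≡⟨ cong₂ ℚ._*_ (√sup≡ d n) (√sup≡ d n) ⟩
    (s n ℚ.+ unit n) ℚ.* (s n ℚ.+ unit n)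
      ≡⟨ expand-sq (s n) (unit n) ⟩
    s n ℚ.* s n ℚ.+ unit n ℚ.* (s n ℚ.+ s n ℚ.+ unit n)
      ≤⟨ ℚ.+-monoʳ-≤ (s n ℚ.* s n)
           (ℚ.*-monoˡ-≤-nonNeg (unit n) {{ℚ.nonNegative (unit-nonNeg n)}}
             (ℚ.+-mono-≤ (ℚ.+-mono-≤ (s≤S n) (s≤S n)) (unit≤1 n))) ⟩
    s n ℚ.* s n ℚ.+ unit n ℚ.* C
      ≤⟨ ℚ.+-monoʳ-≤ (s n ℚ.* s n) (ℚ.*-monoʳ-≤-nonNeg C u≤δ) ⟩
    s n ℚ.* s n ℚ.+ δ ℚ.* C
      ≡⟨ cong (s n ℚ.* s n ℚ.+_) (proj₂ (proj₂ sp)) ⟩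
    s n ℚ.* s n ℚ.+ ε ∎

τ : ℝ
τ = (fromℕ 4 - √ 7) ÷ 9

module Submission where

-- Split the n vertices into classes α, β, γ of sizes n - 2b, b, b. Let G₁ consist of the
-- cliques on α and β, G₂ of the cliques on α and γ, and G₃ of all pairs not inside α. An
-- edge of G₁ and an edge of G₂ that meet lie in a common clique on α, so the third side is
-- missing from G₃. With t = b / n the edge densities are (1 - 4t + 5t²) / 2 twice and
-- 2t - 2t²; they differ from (1 + t²) / 4 by multiples of 9t² - 8t + 1, of which τ is a
-- root. Truncating √7 to r / (m+1) and taking n = 9(m+1), b = 4(m+1) - r makes t the m-th
-- term of the sequence representing τ, and the integer estimate n² + b² ≤ 4|E| + 9n holds.

open import Defs hiding (_+_; _*_; _-_; -_; _<_; _÷_)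
open import Data.Bool.Base using (Bool; true; false; T; if_then_else_)
open import Data.Bool.Properties using (T?)
open import Data.Fin.Base as Fin using (Fin)
open import Data.Fin.Patterns using (0F; 1F; 2F)
import Data.Fin.Properties as Fin
import Data.Integer.Base as ℤ
import Data.Integer.Properties as ℤ
import Data.Integer.Solver as ℤ
open import Data.List.Base
  using (List; []; _∷_; _++_; length; map; filter; lookup; replicate; allFin; cartesianProduct)
open import Data.List.Properties
  using (filter-++; filter-accept; filter-reject; length-++; length-replicate
        ; map-tabulate; tabulate-lookup)
open import Data.Nat.Base as ℕ using (ℕ; zero; suc; s≤s; z≤n; z<s; s<s; s<s⁻¹; s≤s⁻¹)
open import Data.Nat.Combinatorics using (_C_; nC1≡n; nCk+nC[k+1]≡[n+1]C[k+1])
import Data.Nat.Properties as ℕ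
import Data.Nat.Solver as ℕ
open import Data.Product using (Σ-syntax; ∃-syntax; _×_; _,_; proj₁; proj₂; uncurry)
open import Data.Rational.Base as ℚ
  using (ℚ; 0ℚ; 1ℚ; ½; _/_; ∣_∣; toℚᵘ; Positive; positive)
import Data.Rational.Properties as ℚ
import Data.Rational.Solver as ℚ
open import Data.Rational.Unnormalised.Base as ℚᵘ using (mkℚᵘ)
import Data.Rational.Unnormalised.Properties as ℚᵘ
open import Data.Sum.Base using (inj₁; inj₂)
open import Function.Base using (_∘_)
open import Function.Bundles using (_⇔_; mk⇔; Equivalence)
open import Level using (0ℓ)
import Relation.Binary as Binary
open import Relation.Binary using (Rel; Symmetric)
open import Relation.Binary.PropositionalEquality
open import Relation.Nullary using (¬_; yes; no; does)
open import Relation.Nullary.Decidable using (_×-dec_; ¬?)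
open import Relation.Unary using (Pred; Decidable)

module Counting where

  open import Data.Nat.Base using (_+_; _*_; _≤_; _<_)

  -- Counting under filters, in lists and in lists of pairs

  module _ {A B : Set} {P : Pred B 0ℓ} (P? : Decidable P) {Q : Pred A 0ℓ} (Q? : Decidable Q) where

    length-filter-map : (f : A → B) → (∀ x → P (f x) ⇔ Q x) →
      ∀ xs → length (filter P? (map f xs)) ≡ length (filter Q? xs)
    length-filter-map f P⇔Q [] = refl
    length-filter-map f P⇔Q (x ∷ xs) with Q? x
    ... | yes q = trans (cong length (filter-accept P? (Equivalence.from (P⇔Q x) q)))
                        (cong suc (length-filter-map f P⇔Q xs))
    ... | no ¬q = trans (cong length (filter-reject P? (¬q ∘ Equivalence.to (P⇔Q x))))
                        (length-filter-map f P⇔Q xs)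

  length-filter-× : {A B : Set} {P : Pred (A × B) 0ℓ} (P? : Decidable P) → ∀ x xs ys →
    length (filter P? (cartesianProduct (x ∷ xs) ys)) ≡
    length (filter (P? ∘ (x ,_)) ys) + length (filter P? (cartesianProduct xs ys))
  length-filter-× P? x xs ys =
    trans (cong length (filter-++ P? (map (x ,_) ys) (cartesianProduct xs ys)))
    (trans (length-++ (filter P? (map (x ,_) ys)))
           (cong (_+ _) (length-filter-map P? (P? ∘ (x ,_)) (x ,_) (λ _ → mk⇔ (λ p → p) (λ p → p)) ys)))

  module _ {A B : Set} {P : Pred (B × B) 0ℓ} (P? : Decidable P)
           {Q : Pred (A × A) 0ℓ} (Q? : Decidable Q)
           (f : A → B) (b : B) (¬P : ∀ x → ¬ P (f x , b)) (P⇔Q : ∀ x y → P (f x , f y) ⇔ Q (x , y))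
    where

    -- Used with `f` = `Fin.suc` and `b` the vertex zero: edges are listed with the smaller end
    -- first, so the column of zero is empty and the first vertex can be deleted.
    length-filter-×-map : ∀ xs ys →
      length (filter P? (cartesianProduct (map f xs) (b ∷ map f ys))) ≡
      length (filter Q? (cartesianProduct xs ys))
    length-filter-×-map [] ys = refl
    length-filter-×-map (x ∷ xs) ys = begin
      length (filter P? (cartesianProduct (map f (x ∷ xs)) (b ∷ map f ys)))
        ≡⟨ length-filter-× P? (f x) (map f xs) (b ∷ map f ys) ⟩
      length (filter (P? ∘ (f x ,_)) (b ∷ map f ys)) +
      length (filter P? (cartesianProduct (map f xs) (b ∷ map f ys)))
        ≡⟨ cong₂ _+_
             (trans (cong length (filter-reject (P? ∘ (f x ,_)) (¬P x)))
                    (length-filter-map (P? ∘ (f x ,_)) (Q? ∘ (x ,_)) f (P⇔Q x) ys))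
             (length-filter-×-map xs ys) ⟩
      length (filter (Q? ∘ (x ,_)) ys) + length (filter Q? (cartesianProduct xs ys))
        ≡⟨ length-filter-× Q? x xs ys ⟨
      length (filter Q? (cartesianProduct (x ∷ xs) ys)) ∎
      where open ≡-Reasoning

  -- Edge counts of graphs given by vertex labels

  module _ {L : Set} {R : Rel L 0ℓ} (R? : Binary.Decidable R) where

    -- Pairs are taken by position, earlier before later, so equal labels at two positions count
    -- when the label is related to itself.
    relatedPairs : List L → ℕ
    relatedPairs []       = 0
    relatedPairs (c ∷ cs) = length (filter (R? c) cs) + relatedPairs cs

    length-filter-replicate : ∀ x k c cs →
      length (filter (R? x) (replicate k c ++ cs)) ≡
      (if does (R? x c) then k else 0) + length (filter (R? x) cs)
    length-filter-replicate x zero c cs with does (R? x c)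
    ... | true  = refl
    ... | false = refl
    length-filter-replicate x (suc k) c cs with does (R? x c) | length-filter-replicate x k c cs
    ... | true  | ih = cong suc ih
    ... | false | ih = ih

    -- A block of equal labels is a clique or an independent set, and all its members see the same
    -- part of `cs`. In the clique case, adding one member is Pascal's rule.
    relatedPairs-replicate : ∀ k c cs →
      relatedPairs (replicate k c ++ cs) ≡
      (if does (R? c c) then k C 2 else 0) + (k * length (filter (R? c) cs) + relatedPairs cs)
    relatedPairs-replicate zero c cs with does (R? c c)
    ... | true  = refl
    ... | false = refl
    relatedPairs-replicate (suc k) c cs
      rewrite length-filter-replicate c k c cs | relatedPairs-replicate k c cs
      with does (R? c c)
    ... | true  = begin
      k + e + (k C 2 + (k * e + p))      ≡⟨ solve 4 (λ k e c p → k :+ e :+ (c :+ (k :* e :+ p))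
                                              := k :+ c :+ (e :+ k :* e :+ p)) refl k e (k C 2) p ⟩
      k + k C 2 + (e + k * e + p)        ≡⟨ cong (λ t → t + k C 2 + (e + k * e + p)) (nC1≡n k) ⟨
      k C 1 + k C 2 + (e + k * e + p)    ≡⟨ cong (_+ (e + k * e + p)) (nCk+nC[k+1]≡[n+1]C[k+1] k 1) ⟩
      suc k C 2 + (e + k * e + p)        ∎
      where
      open ≡-Reasoning
      open ℕ.+-*-Solver
      e = length (filter (R? c) cs)
      p = relatedPairs cs
    ... | false = sym (ℕ.+-assoc (length (filter (R? c) cs)) _ _)

    module _ (R-sym : Symmetric R) where

      -- A label related to itself makes its class a clique, so `u ≢ v` is what excludes loops.
      labelledGraph : (cs : List L) → Graph (length cs)
      labelledGraph cs = record
        { Adj    = λ u v → u ≢ v × R (lookup cs u) (lookup cs v)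
        ; adj?   = λ u v → ¬? (u Fin.≟ v) ×-dec R? (lookup cs u) (lookup cs v)
        ; symm   = λ (u≢v , r) → u≢v ∘ sym , R-sym r
        ; irrefl = λ u≡v (u≢v , _) → u≢v u≡v
        }

      -- Induction by deleting the first vertex: its row gives the labels related to `c`, its column
      -- gives nothing, and shifting by `Fin.suc` identifies the rest with the smaller graph.
      ∣E∣-labelledGraph : ∀ cs → ∣E labelledGraph cs ∣ ≡ relatedPairs cs
      ∣E∣-labelledGraph [] = refl
      ∣E∣-labelledGraph (c ∷ cs) = begin
        ∣E labelledGraph (c ∷ cs) ∣
          ≡⟨ cong (λ vs → length (filter P? (cartesianProduct (Fin.zero ∷ vs) (Fin.zero ∷ vs))))
                  (sym (map-tabulate (λ i → i) Fin.suc)) ⟩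
        length (filter P? (cartesianProduct (Fin.zero ∷ map Fin.suc is) (Fin.zero ∷ map Fin.suc is)))
          ≡⟨ length-filter-× P? Fin.zero (map Fin.suc is) (Fin.zero ∷ map Fin.suc is) ⟩
        length (filter (P? ∘ (Fin.zero ,_)) (Fin.zero ∷ map Fin.suc is)) +
        length (filter P? (cartesianProduct (map Fin.suc is) (Fin.zero ∷ map Fin.suc is)))
          ≡⟨ cong₂ _+_ row rest ⟩
        length (filter (R? c) cs) + ∣E labelledGraph cs ∣
          ≡⟨ cong (length (filter (R? c) cs) +_) (∣E∣-labelledGraph cs) ⟩
        relatedPairs (c ∷ cs) ∎
        where
        open ≡-Reasoning
        is = allFin (length cs)
        G = labelledGraph (c ∷ cs)
        H = labelledGraph cs
        P? : Decidable (uncurry λ u v → u Fin.< v × Adj G u v)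
        P? = uncurry λ u v → (u Fin.<? v) ×-dec adj? G u v
        Q? : Decidable (uncurry λ u v → u Fin.< v × Adj H u v)
        Q? = uncurry λ u v → (u Fin.<? v) ×-dec adj? H u v
        row : length (filter (P? ∘ (Fin.zero ,_)) (Fin.zero ∷ map Fin.suc is)) ≡ length (filter (R? c) cs)
        row = begin
          length (filter (P? ∘ (Fin.zero ,_)) (Fin.zero ∷ map Fin.suc is))
            -- The pair of zero with itself is already dropped by computation, since zero is not
            -- below zero.
            ≡⟨ length-filter-map (P? ∘ (Fin.zero ,_)) (R? c ∘ lookup cs) Fin.suc
                 (λ i → mk⇔ (λ (_ , _ , r) → r) (λ r → z<s , (λ ()) , r)) is ⟩
          length (filter (R? c ∘ lookup cs) is)
            ≡⟨ length-filter-map (R? c) (R? c ∘ lookup cs) (lookup cs)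
                 (λ _ → mk⇔ (λ r → r) (λ r → r)) is ⟨
          length (filter (R? c) (map (lookup cs) is))
            ≡⟨ cong (length ∘ filter (R? c))
                    (trans (map-tabulate (λ i → i) (lookup cs)) (tabulate-lookup cs)) ⟩
          length (filter (R? c) cs) ∎
        rest : length (filter P? (cartesianProduct (map Fin.suc is) (Fin.zero ∷ map Fin.suc is))) ≡ ∣E H ∣
        rest = length-filter-×-map P? Q? Fin.suc Fin.zero (λ _ ()) 
          (λ i j → mk⇔ (λ (i<j , i≢j , r) → s<s⁻¹ i<j , i≢j ∘ cong Fin.suc , r)
                       (λ (i<j , i≢j , r) → s<s i<j , i≢j ∘ Fin.suc-injective , r)) is is

  -- The three classes, rainbow-freeness and exact edge counts

  data Class : Set where
    α β γ : Class

  joined : Fin 3 → Class → Class → Bool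
  joined 0F α α = true
  joined 0F β β = true
  joined 1F α α = true
  joined 1F γ γ = true
  joined 2F α α = false
  joined 2F _ _ = true
  joined _  _ _ = false

  joined? : ∀ i → Binary.Decidable (λ x y → T (joined i x y))
  joined? i x y = T? (joined i x y)

  joined-sym : ∀ i → Symmetric (λ x y → T (joined i x y))
  joined-sym 0F {α} {α} j = j
  joined-sym 0F {β} {β} j = j
  joined-sym 1F {α} {α} j = j
  joined-sym 1F {γ} {γ} j = j
  joined-sym 2F {α} {β} j = j
  joined-sym 2F {α} {γ} j = j
  joined-sym 2F {β} {α} j = j
  joined-sym 2F {β} {β} j = j
  joined-sym 2F {β} {γ} j = j
  joined-sym 2F {γ} {α} j = j
  joined-sym 2F {γ} {β} j = j
  joined-sym 2F {γ} {γ} j = j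

  -- The middle label decides: `γ` meets nothing under `0F`, `β` meets nothing under `1F`, and `α`
  -- meets only `α` under both. Hence all three labels are `α`, which `2F` forbids.
  joined-rainbow-free : ∀ x y z → T (joined 0F x y) → T (joined 1F y z) → ¬ T (joined 2F z x)
  joined-rainbow-free α α α _ _ ()
  joined-rainbow-free α α β _ ()
  joined-rainbow-free α α γ _ ()
  joined-rainbow-free β β α _ ()
  joined-rainbow-free β β β _ ()
  joined-rainbow-free β β γ _ ()
  joined-rainbow-free α β _ ()
  joined-rainbow-free α γ _ ()
  joined-rainbow-free β α _ ()
  joined-rainbow-free β γ _ ()
  joined-rainbow-free γ α _ ()
  joined-rainbow-free γ β _ ()
  joined-rainbow-free γ γ _ ()

  module _ (a b : ℕ) where

    -- The final `[]` gives the last block the form `replicate k c ++ cs` that the block lemmas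
    -- expect.
    classes : List Class
    classes = replicate a α ++ replicate b β ++ replicate b γ ++ []

    length-classes : length classes ≡ a + (b + b)
    length-classes
      rewrite length-++ (replicate a α) {replicate b β ++ replicate b γ ++ []}
            | length-++ (replicate b β) {replicate b γ ++ []}
            | length-++ (replicate b γ) {[]}
            | length-replicate a {α} | length-replicate b {β} | length-replicate b {γ}
            | ℕ.+-identityʳ b = refl

    graph : Fin 3 → Graph (length classes)
    graph i = labelledGraph (joined? i) (joined-sym i) classes

    graph-rainbow-free : ¬ RainbowTriangle graph
    graph-rainbow-free (v₁ , v₂ , v₃ , _ , (_ , j₀) , (_ , j₁) , (_ , j₂)) =
      joined-rainbow-free (lookup classes v₁) (lookup classes v₂) (lookup classes v₃) j₀ j₁ j₂

    -- For `2F`, the bracket is the clique on the union of `β` and `γ`, split by blocks.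
    edgeCount : Fin 3 → ℕ
    edgeCount 0F = a C 2 + b C 2
    edgeCount 1F = a C 2 + b C 2
    edgeCount 2F = a * (b + b) + (b C 2 + (b * b + b C 2))

    ∣E∣-graph : ∀ i → ∣E graph i ∣ ≡ edgeCount i
    ∣E∣-graph i = trans (byBlocks i) (simplify i)
      where
      -- This copies the output of the block lemmas, zeros included, so that the rewriting below
      -- ends in `refl` for all `i` at once.
      byPairs : Fin 3 → ℕ
      byPairs i = pairs α α (a C 2) +
        (a * (pairs α β b + (pairs α γ b + 0)) + (pairs β β (b C 2) +
          (b * (pairs β γ b + 0) + (pairs γ γ (b C 2) + (b * 0 + 0)))))
        where
        pairs : Class → Class → ℕ → ℕ
        pairs x y k = if joined i x y then k else 0
      byBlocks : ∀ i → ∣E graph i ∣ ≡ byPairs i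
      byBlocks i
        rewrite ∣E∣-labelledGraph (joined? i) (joined-sym i) classes
              | relatedPairs-replicate (joined? i) a α (replicate b β ++ replicate b γ ++ [])
              | relatedPairs-replicate (joined? i) b β (replicate b γ ++ [])
              | relatedPairs-replicate (joined? i) b γ []
              | length-filter-replicate (joined? i) α b β (replicate b γ ++ [])
              | length-filter-replicate (joined? i) α b γ []
              | length-filter-replicate (joined? i) β b γ []
        = refl
      open ℕ.+-*-Solver
      simplify : ∀ i → byPairs i ≡ edgeCount i
      simplify 0F = solve 4 (λ a b x y →
        x :+ (a :* con 0 :+ (y :+ (b :* con 0 :+ (b :* con 0 :+ con 0)))) := x :+ y)
        refl a b (a C 2) (b C 2)
      simplify 1F = solve 4 (λ a b x y →
        x :+ (a :* con 0 :+ (b :* con 0 :+ (y :+ (b :* con 0 :+ con 0)))) := x :+ y)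
        refl a b (a C 2) (b C 2)
      simplify 2F = solve 3 (λ a b y →
        a :* (b :+ (b :+ con 0)) :+ (y :+ (b :* (b :+ con 0) :+ (y :+ (b :* con 0 :+ con 0))))
          := a :* (b :+ b) :+ (y :+ (b :* b :+ y)))
        refl a b (b C 2)

  -- Integer edge estimates from a truncation of √7

  2*nC2+n≡n*n : ∀ n → 2 * (n C 2) + n ≡ n * n
  2*nC2+n≡n*n zero    = refl
  2*nC2+n≡n*n (suc n) = begin
    2 * (suc n C 2) + suc n        ≡⟨ cong (λ t → 2 * t + suc n) (nCk+nC[k+1]≡[n+1]C[k+1] n 1) ⟨
    2 * (n C 1 + n C 2) + suc n    ≡⟨ cong (λ t → 2 * (t + n C 2) + suc n) (nC1≡n n) ⟩
    2 * (n + n C 2) + suc n        ≡⟨ solve 2 (λ n c → con 2 :* (n :+ c) :+ (con 1 :+ n)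
                                        := con 2 :* c :+ n :+ (con 1 :+ con 2 :* n)) refl n (n C 2) ⟩
    2 * (n C 2) + n + (1 + 2 * n)  ≡⟨ cong (_+ (1 + 2 * n)) (2*nC2+n≡n*n n) ⟩
    n * n + (1 + 2 * n)            ≡⟨ solve 1 (λ n → n :* n :+ (con 1 :+ con 2 :* n)
                                        := (con 1 :+ n) :* (con 1 :+ n)) refl n ⟩
    suc n * suc n                  ∎
    where
    open ≡-Reasoning
    open ℕ.+-*-Solver

  -- The crude bound √7 ≤ 3. It makes `4 * M ∸ r` a true subtraction and keeps the rounding error
  -- linear in `M`.
  sq≤7⇒≤3* : ∀ m r → r * r ≤ 7 * (m * m) → r ≤ 3 * m
  sq≤7⇒≤3* m r r²≤7m² = s≤s⁻¹ (sq-cancel-< r (suc (3 * m)) (begin-strict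
    r * r                        ≤⟨ r²≤7m² ⟩
    7 * (m * m)                  ≤⟨ ℕ.*-monoˡ-≤ (m * m) (ℕ.m≤m+n 7 2) ⟩
    9 * (m * m)                  ≡⟨ solve 1 (λ m → con 9 :* (m :* m) := con 3 :* m :* (con 3 :* m)) refl m ⟩
    3 * m * (3 * m)              <⟨ ℕ.*-mono-< (ℕ.n<1+n (3 * m)) (ℕ.n<1+n (3 * m)) ⟩
    suc (3 * m) * suc (3 * m)    ∎))
    where
    open ℕ.≤-Reasoning
    open ℕ.+-*-Solver

  module Truncation (M r b : ℕ) (M≥1 : 1 ≤ M) (b+r≡4M : b + r ≡ 4 * M)
           (r²≤7M² : r * r ≤ 7 * (M * M)) (7M²<r+1² : 7 * (M * M) < suc r * suc r) where

    private
      -- This is `n - 2b` for `n = 9M` and `b = 4M - r`, written without subtraction.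
      a = M + 2 * r
      n = a + (b + b)

    open ℕ.+-*-Solver

    n≡9M : n ≡ 9 * M
    n≡9M = begin
      M + 2 * r + (b + b)  ≡⟨ solve 3 (λ M r b → M :+ con 2 :* r :+ (b :+ b)
                                := M :+ con 2 :* (b :+ r)) refl M r b ⟩
      M + 2 * (b + r)      ≡⟨ cong (λ t → M + 2 * t) b+r≡4M ⟩
      M + 2 * (4 * M)      ≡⟨ solve 1 (λ M → M :+ con 2 :* (con 4 :* M) := con 9 :* M) refl M ⟩
      9 * M                ∎
      where open ≡-Reasoning

    private
      -- Multiplied by 16 so that 4M = b + r eliminates M without subtraction.
      balance : a * a + 63 * (M * M) ≡ 4 * (a * b) + 3 * (b * b) + 9 * (r * r)
      balance = ℕ.*-cancelˡ-≡ _ _ 16 (begin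
        16 * (a * a + 63 * (M * M))
          ≡⟨ solve 2 (λ M r → con 16 :* ((M :+ con 2 :* r) :* (M :+ con 2 :* r) :+ con 63 :* (M :* M))
               := (con 4 :* M :+ con 8 :* r) :* (con 4 :* M :+ con 8 :* r)
                  :+ con 63 :* (con 4 :* M :* (con 4 :* M))) refl M r ⟩
        (4 * M + 8 * r) * (4 * M + 8 * r) + 63 * (4 * M * (4 * M))
          ≡⟨ cong (λ t → (t + 8 * r) * (t + 8 * r) + 63 * (t * t)) b+r≡4M ⟨
        (b + r + 8 * r) * (b + r + 8 * r) + 63 * ((b + r) * (b + r))
          ≡⟨ solve 2 (λ b r → (b :+ r :+ con 8 :* r) :* (b :+ r :+ con 8 :* r)
                              :+ con 63 :* ((b :+ r) :* (b :+ r))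
               := con 16 :* ((b :+ r :+ con 8 :* r) :* b) :+ con 48 :* (b :* b) :+ con 144 :* (r :* r))
               refl b r ⟩
        16 * ((b + r + 8 * r) * b) + 48 * (b * b) + 144 * (r * r)
          ≡⟨ cong (λ t → 16 * ((t + 8 * r) * b) + 48 * (b * b) + 144 * (r * r)) b+r≡4M ⟩
        16 * ((4 * M + 8 * r) * b) + 48 * (b * b) + 144 * (r * r)
          ≡⟨ solve 3 (λ M r b → con 16 :* ((con 4 :* M :+ con 8 :* r) :* b)
                                :+ con 48 :* (b :* b) :+ con 144 :* (r :* r)
               := con 16 :* (con 4 :* ((M :+ con 2 :* r) :* b) :+ con 3 :* (b :* b) :+ con 9 :* (r :* r)))
               refl M r b ⟩
        16 * (4 * (a * b) + 3 * (b * b) + 9 * (r * r)) ∎)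
        where open ≡-Reasoning

    -- Substituting `a = n - 2b`, `balance` says n² - 8nb + 9b² = 9(r² - 7M²), the integer form of
    -- 9t² - 8t + 1. Up to the linear terms of the binomials, `4|E| - n² - b²` is this quantity.
    -- Truncation makes it nonpositive, so the upper estimate on 7M² is needed to bound the loss.
    cliques-bound : n * n + b * b ≤ 4 * (a C 2 + b C 2) + 9 * n
    cliques-bound = ℕ.+-cancelʳ-≤ (2 * a + 2 * b + 9 * (r * r)) _ _ (begin
      n * n + b * b + (2 * a + 2 * b + 9 * (r * r))
        ≡⟨ solve 3 (λ a b r → (a :+ (b :+ b)) :* (a :+ (b :+ b)) :+ b :* b
                              :+ (con 2 :* a :+ con 2 :* b :+ con 9 :* (r :* r))
             := a :* a :+ con 2 :* (b :* b) :+ con 2 :* a :+ con 2 :* b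
                :+ (con 4 :* (a :* b) :+ con 3 :* (b :* b) :+ con 9 :* (r :* r))) refl a b r ⟩
      a * a + 2 * (b * b) + 2 * a + 2 * b + (4 * (a * b) + 3 * (b * b) + 9 * (r * r))
        ≡⟨ cong (a * a + 2 * (b * b) + 2 * a + 2 * b +_) balance ⟨
      a * a + 2 * (b * b) + 2 * a + 2 * b + (a * a + 63 * (M * M))
        ≡⟨ solve 3 (λ a b M → a :* a :+ con 2 :* (b :* b) :+ con 2 :* a :+ con 2 :* b
                              :+ (a :* a :+ con 63 :* (M :* M))
             := con 2 :* (a :* a) :+ con 2 :* (b :* b) :+ con 2 :* a :+ con 2 :* b
                :+ con 9 :* (con 7 :* (M :* M))) refl a b M ⟩
      2 * (a * a) + 2 * (b * b) + 2 * a + 2 * b + 9 * (7 * (M * M))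
        -- Doubling `2 * b` completes `2 * a + 2 * b` to `2 * n`.
        ≤⟨ ℕ.+-mono-≤ (ℕ.+-monoʳ-≤ (2 * (a * a) + 2 * (b * b) + 2 * a) (ℕ.m≤m+n (2 * b) (2 * b)))
             (ℕ.*-monoʳ-≤ 9 (ℕ.<⇒≤ 7M²<r+1²)) ⟩
      2 * (a * a) + 2 * (b * b) + 2 * a + (2 * b + 2 * b) + 9 * (suc r * suc r)
        ≡⟨ solve 3 (λ a b r → con 2 :* (a :* a) :+ con 2 :* (b :* b) :+ con 2 :* a
                              :+ (con 2 :* b :+ con 2 :* b) :+ con 9 :* ((con 1 :+ r) :* (con 1 :+ r))
             := con 2 :* (a :* a) :+ con 2 :* (b :* b) :+ con 9 :* (r :* r)
                :+ (con 2 :* (a :+ (b :+ b)) :+ (con 18 :* r :+ con 9 :* con 1))) refl a b r ⟩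
      2 * (a * a) + 2 * (b * b) + 9 * (r * r) + (2 * n + (18 * r + 9 * 1))
        -- The rounding loss 18r + 9 is at most 54M + 9M = 7n; with `2 * n` this gives the constant
        -- 9.
        ≤⟨ ℕ.+-monoʳ-≤ (2 * (a * a) + 2 * (b * b) + 9 * (r * r)) (ℕ.+-monoʳ-≤ (2 * n)
             (ℕ.+-mono-≤ (ℕ.*-monoʳ-≤ 18 (sq≤7⇒≤3* M r r²≤7M²)) (ℕ.*-monoʳ-≤ 9 M≥1))) ⟩
      2 * (a * a) + 2 * (b * b) + 9 * (r * r) + (2 * n + (18 * (3 * M) + 9 * M))
        ≡⟨ cong (2 * (a * a) + 2 * (b * b) + 9 * (r * r) +_) (trans
             (solve 2 (λ n M → con 2 :* n :+ (con 18 :* (con 3 :* M) :+ con 9 :* M)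
               := con 2 :* n :+ con 7 :* (con 9 :* M)) refl n M)
             (trans (cong (λ t → 2 * n + 7 * t) (sym n≡9M))
               (solve 1 (λ n → con 2 :* n :+ con 7 :* n := con 9 :* n) refl n))) ⟩
      2 * (a * a) + 2 * (b * b) + 9 * (r * r) + 9 * n
        ≡⟨ cong₂ (λ s t → 2 * s + 2 * t + 9 * (r * r) + 9 * n) (2*nC2+n≡n*n a) (2*nC2+n≡n*n b) ⟨
      2 * (2 * (a C 2) + a) + 2 * (2 * (b C 2) + b) + 9 * (r * r) + 9 * n
        ≡⟨ solve 6 (λ a b x y r n → con 2 :* (con 2 :* x :+ a) :+ con 2 :* (con 2 :* y :+ b)
                                    :+ con 9 :* (r :* r) :+ con 9 :* n
             := con 4 :* (x :+ y) :+ con 9 :* n :+ (con 2 :* a :+ con 2 :* b :+ con 9 :* (r :* r)))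
             refl a b (a C 2) (b C 2) r n ⟩
      4 * (a C 2 + b C 2) + 9 * n + (2 * a + 2 * b + 9 * (r * r)) ∎)
      where open ℕ.≤-Reasoning

    -- Here the quantity from `balance` enters with the opposite sign, so rounding √7 down helps: r²
    -- ≤ 7M² suffices and only the error `4 * b` from the binomials is left.
    complement-bound : n * n + b * b ≤ 4 * (a * (b + b) + (b C 2 + (b * b + b C 2))) + 9 * n
    complement-bound = ℕ.+-cancelʳ-≤ (63 * (M * M) + 4 * b) _ _ (begin
      n * n + b * b + (63 * (M * M) + 4 * b)
        ≡⟨ solve 3 (λ a b M → (a :+ (b :+ b)) :* (a :+ (b :+ b)) :+ b :* b :+ (con 63 :* (M :* M) :+ con 4 :* b)
             := con 4 :* (a :* b) :+ con 5 :* (b :* b) :+ con 4 :* b :+ (a :* a :+ con 63 :* (M :* M)))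
             refl a b M ⟩
      4 * (a * b) + 5 * (b * b) + 4 * b + (a * a + 63 * (M * M))
        ≡⟨ cong (4 * (a * b) + 5 * (b * b) + 4 * b +_) balance ⟩
      4 * (a * b) + 5 * (b * b) + 4 * b + (4 * (a * b) + 3 * (b * b) + 9 * (r * r))
        ≤⟨ ℕ.+-mono-≤ (ℕ.+-monoʳ-≤ (4 * (a * b) + 5 * (b * b)) 4b≤9n)
             (ℕ.+-monoʳ-≤ (4 * (a * b) + 3 * (b * b)) (ℕ.*-monoʳ-≤ 9 r²≤7M²)) ⟩
      4 * (a * b) + 5 * (b * b) + 9 * n + (4 * (a * b) + 3 * (b * b) + 9 * (7 * (M * M)))
        ≡⟨ solve 4 (λ a b M n → con 4 :* (a :* b) :+ con 5 :* (b :* b) :+ con 9 :* n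
                                :+ (con 4 :* (a :* b) :+ con 3 :* (b :* b) :+ con 9 :* (con 7 :* (M :* M)))
             := con 8 :* (a :* b) :+ con 4 :* (b :* b) :+ con 4 :* (b :* b) :+ con 9 :* n :+ con 63 :* (M :* M))
             refl a b M n ⟩
      8 * (a * b) + 4 * (b * b) + 4 * (b * b) + 9 * n + 63 * (M * M)
        ≡⟨ cong (λ t → 8 * (a * b) + 4 * (b * b) + 4 * t + 9 * n + 63 * (M * M)) (2*nC2+n≡n*n b) ⟨
      8 * (a * b) + 4 * (b * b) + 4 * (2 * (b C 2) + b) + 9 * n + 63 * (M * M)
        ≡⟨ solve 5 (λ a b M n y → con 8 :* (a :* b) :+ con 4 :* (b :* b) :+ con 4 :* (con 2 :* y :+ b)
                                  :+ con 9 :* n :+ con 63 :* (M :* M)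
             := con 4 :* (a :* (b :+ b) :+ (y :+ (b :* b :+ y))) :+ con 9 :* n :+ (con 63 :* (M :* M) :+ con 4 :* b))
             refl a b M n (b C 2) ⟩
      4 * (a * (b + b) + (b C 2 + (b * b + b C 2))) + 9 * n + (63 * (M * M) + 4 * b) ∎)
      where
      open ℕ.≤-Reasoning
      4b≤9n : 4 * b ≤ 9 * n
      4b≤9n = ℕ.*-mono-≤ (ℕ.m≤m+n 4 5) (ℕ.≤-trans (ℕ.m≤m+n b b) (ℕ.m≤n+m (b + b) a))

    edgeCount-bound : ∀ i → n * n + b * b ≤ 4 * edgeCount a b i + 9 * n
    edgeCount-bound 0F = cliques-bound
    edgeCount-bound 1F = cliques-bound
    edgeCount-bound 2F = complement-bound

open Counting

module Estimates where

  open import Data.Integer.Base using (+_)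
  open import Data.Rational.Base using (_+_; _*_; _-_; -_; _≤_; _<_)

  -- Transfer of the integer estimates to rationals

  ι : ℕ → ℚ
  ι k = + k / 1

  toℚᵘ-/ : ∀ p d → toℚᵘ (p / suc d) ℚᵘ.≃ mkℚᵘ p d
  toℚᵘ-/ p d = ℚ.toℚᵘ-fromℚᵘ (mkℚᵘ p d)

  ι-+ : ∀ m n → ι (m ℕ.+ n) ≡ ι m + ι n
  ι-+ m n = ℚ.toℚᵘ-injective (begin
    toℚᵘ (ι (m ℕ.+ n))                ≈⟨ toℚᵘ-/ (+ (m ℕ.+ n)) 0 ⟩
    mkℚᵘ (+ m ℤ.+ + n) 0              ≈⟨ ℚᵘ.*≡* (solve 2 (λ m n → (m :+ n) :* con (+ 1)
                                           := (m :* con (+ 1) :+ n :* con (+ 1)) :* con (+ 1)) refl (+ m) (+ n)) ⟩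
    mkℚᵘ (+ m) 0 ℚᵘ.+ mkℚᵘ (+ n) 0    ≈⟨ ℚᵘ.+-cong (toℚᵘ-/ (+ m) 0) (toℚᵘ-/ (+ n) 0) ⟨
    toℚᵘ (ι m) ℚᵘ.+ toℚᵘ (ι n)        ≈⟨ ℚ.toℚᵘ-homo-+ (ι m) (ι n) ⟨
    toℚᵘ (ι m + ι n)                  ∎)
    where
    open import Relation.Binary.Reasoning.Setoid ℚᵘ.≃-setoid
    open ℤ.+-*-Solver

  ι-* : ∀ m n → ι (m ℕ.* n) ≡ ι m * ι n
  ι-* m n = ℚ.toℚᵘ-injective (begin
    toℚᵘ (ι (m ℕ.* n))                ≈⟨ toℚᵘ-/ (+ (m ℕ.* n)) 0 ⟩
    mkℚᵘ (+ (m ℕ.* n)) 0              ≈⟨ ℚᵘ.*≡* (cong (ℤ._* + 1) (ℤ.pos-* m n)) ⟩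
    mkℚᵘ (+ m) 0 ℚᵘ.* mkℚᵘ (+ n) 0    ≈⟨ ℚᵘ.*-cong (toℚᵘ-/ (+ m) 0) (toℚᵘ-/ (+ n) 0) ⟨
    toℚᵘ (ι m) ℚᵘ.* toℚᵘ (ι n)        ≈⟨ ℚ.toℚᵘ-homo-* (ι m) (ι n) ⟨
    toℚᵘ (ι m * ι n)                  ∎)
    where open import Relation.Binary.Reasoning.Setoid ℚᵘ.≃-setoid

  ι-mono-≤ : ∀ {m n} → m ℕ.≤ n → ι m ≤ ι n
  ι-mono-≤ {m} {n} m≤n = ℚ.toℚᵘ-cancel-≤
    (ℚᵘ.≤-respˡ-≃ (ℚᵘ.≃-sym (toℚᵘ-/ (+ m) 0))
    (ℚᵘ.≤-respʳ-≃ (ℚᵘ.≃-sym (toℚᵘ-/ (+ n) 0))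
    (ℚᵘ.*≤* (ℤ.*-monoʳ-≤-nonNeg (+ 1) (ℤ.+≤+ m≤n)))))

  /-*-cancel : ∀ k d → (+ k / suc d) * ι (suc d) ≡ ι k
  /-*-cancel k d = ℚ.toℚᵘ-injective (begin
    toℚᵘ ((+ k / suc d) * ι (suc d))           ≈⟨ ℚ.toℚᵘ-homo-* (+ k / suc d) (ι (suc d)) ⟩
    toℚᵘ (+ k / suc d) ℚᵘ.* toℚᵘ (ι (suc d))   ≈⟨ ℚᵘ.*-cong (toℚᵘ-/ (+ k) d) (toℚᵘ-/ (+ suc d) 0) ⟩
    mkℚᵘ (+ k) d ℚᵘ.* mkℚᵘ (+ suc d) 0         ≈⟨ ℚᵘ.*≡* (solve 2 (λ k d → k :* d :* con (+ 1)
                                                    := k :* (d :* con (+ 1))) refl (+ k) (+ suc d)) ⟩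
    mkℚᵘ (+ k) 0                               ≈⟨ toℚᵘ-/ (+ k) 0 ⟨
    toℚᵘ (ι k)                                 ∎)
    where
    open import Relation.Binary.Reasoning.Setoid ℚᵘ.≃-setoid
    open ℤ.+-*-Solver

  p≤∣p∣ : ∀ p → p ≤ ∣ p ∣
  p≤∣p∣ p with ℚ.≤-total 0ℚ p
  ... | inj₁ 0≤p = ℚ.≤-reflexive (sym (ℚ.0≤p⇒∣p∣≡p 0≤p))
  ... | inj₂ p≤0 = ℚ.≤-trans p≤0 (ℚ.0≤∣p∣ p)

  ∣p-q∣<r⇒p<q+r : ∀ p q {r} → ∣ p - q ∣ < r → p < q + r
  ∣p-q∣<r⇒p<q+r p q {r} h = begin-strict
    p              ≡⟨ solve 2 (λ p q → p := q :+ (p :- q)) refl p q ⟩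
    q + (p - q)    ≤⟨ ℚ.+-monoʳ-≤ q (p≤∣p∣ (p - q)) ⟩
    q + ∣ p - q ∣  <⟨ ℚ.+-monoʳ-< q h ⟩
    q + r          ∎
    where
    open ℚ.≤-Reasoning
    open ℚ.+-*-Solver

  density : ∀ {N B t e} → t * N ≡ B → N * N + B * B ≤ ι 4 * e + ι 9 * N →
    (1ℚ + t * t) * (N * N) ≤ ι 4 * e + ι 9 * N
  density {N} {B} {t} {e} tN≡B bound = begin
    (1ℚ + t * t) * (N * N)       ≡⟨ solve 2 (λ t N → (con 1ℚ :+ t :* t) :* (N :* N)
                                      := N :* N :+ t :* N :* (t :* N)) refl t N ⟩
    N * N + t * N * (t * N)      ≡⟨ cong (λ B → N * N + B * B) tN≡B ⟩
    N * N + B * B                ≤⟨ bound ⟩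
    ι 4 * e + ι 9 * N            ∎
    where
    open ℚ.≤-Reasoning
    open ℚ.+-*-Solver

  -- Here `u` is 1/M. Since N = 9M, the linear error `9N` is exactly `u` times N².
  9N≤δN² : ∀ {u M N δ} → Positive N → u * M ≡ 1ℚ → N ≡ ι 9 * M → u ≤ δ → ι 9 * N ≤ δ * (N * N)
  9N≤δN² {u} {M} {N} {δ} N>0 uM≡1 N≡9M u≤δ = begin
    ι 9 * N              ≡⟨ solve 1 (λ N → con (ι 9) :* N := con (ι 9) :* con 1ℚ :* N) refl N ⟩
    ι 9 * 1ℚ * N         ≡⟨ cong (λ t → ι 9 * t * N) uM≡1 ⟨
    ι 9 * (u * M) * N    ≡⟨ solve 3 (λ u M N → con (ι 9) :* (u :* M) :* N
                              := u :* (con (ι 9) :* M) :* N) refl u M N ⟩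
    u * (ι 9 * M) * N    ≡⟨ cong (λ t → u * t * N) N≡9M ⟨
    u * N * N            ≤⟨ ℚ.*-monoʳ-≤-nonNeg N (ℚ.*-monoʳ-≤-nonNeg N u≤δ) ⟩
    δ * N * N            ≡⟨ ℚ.*-assoc δ N N ⟩
    δ * (N * N)          ∎
    where
    open ℚ.≤-Reasoning
    open ℚ.+-*-Solver
    instance
      _ = N>0
      _ = ℚ.pos⇒nonNeg N

  gap : ℚ → ℚ → ℚ
  gap N δ = δ * ½ * (N * N)

  gap>0 : ∀ {N δ} → Positive N → 0ℚ < δ → 0ℚ < gap N δ
  gap>0 {N} {δ} N>0 δ>0 = ℚ.positive⁻¹ (gap N δ) {{ℚ.pos*pos⇒pos (δ * ½) (N * N)}}
    where
    instance
      _ = N>0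
      _ = positive δ>0
      _ = ℚ.pos*pos⇒pos δ ½
      _ = ℚ.pos*pos⇒pos N N

  -- A budget in units of δN²: replacing `q` by `p` costs a quarter, the linear error another
  -- quarter, and `ε` exceeds `δ`, so a half remains. That half is `gap`.
  edge-gap : ∀ {p q ε δ N e} → Positive N → (1ℚ + p) * (N * N) ≤ ι 4 * e + δ * (N * N) →
    ∣ q - p ∣ < δ → δ < ε → ((1ℚ + q) * (+ 1 / 4) - ε) * (N * N) + gap N δ < e
  edge-gap {p} {q} {ε} {δ} {N} {e} N>0 dense q≈p δ<ε = begin-strict
    ((1ℚ + q) * ¼ - ε) * W + δ * ½ * W
      <⟨ ℚ.+-monoˡ-< (δ * ½ * W) (ℚ.*-monoˡ-<-pos W (ℚ.+-mono-<
           (ℚ.*-monoˡ-<-pos ¼ (ℚ.+-monoʳ-< 1ℚ (∣p-q∣<r⇒p<q+r q p q≈p)))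
           (ℚ.neg-antimono-< δ<ε))) ⟩
    ((1ℚ + (p + δ)) * ¼ - δ) * W + δ * ½ * W
      ≡⟨ solve 3 (λ p δ W → ((con 1ℚ :+ (p :+ δ)) :* con ¼ :- δ) :* W :+ δ :* con ½ :* W
           := con ¼ :* ((con 1ℚ :+ p) :* W) :- con ¼ :* (δ :* W)) refl p δ W ⟩
    ¼ * ((1ℚ + p) * W) - ¼ * (δ * W)
      ≤⟨ ℚ.+-monoˡ-≤ (- (¼ * (δ * W))) (ℚ.*-monoˡ-≤-nonNeg ¼ dense) ⟩
    ¼ * (ι 4 * e + δ * W) - ¼ * (δ * W)
      ≡⟨ solve 2 (λ e d → con ¼ :* (con (ι 4) :* e :+ d) :- con ¼ :* d := e) refl e (δ * W) ⟩
    e ∎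
    where
    open ℚ.≤-Reasoning
    open ℚ.+-*-Solver
    ¼ = + 1 / 4
    W = N * N
    instance
      _ = N>0
      _ = ℚ.pos*pos⇒pos N N

  -- The graphs belonging to one term of the sequence for τ

  module Construction (m : ℕ) where

    r M a b n : ℕ
    r = √num 7 m
    M = suc m
    b = 4 ℕ.* M ℕ.∸ r
    a = M ℕ.+ 2 ℕ.* r
    n = a ℕ.+ (b ℕ.+ b)

    r²≤7M² : r ℕ.* r ℕ.≤ 7 ℕ.* (M ℕ.* M)
    r²≤7M² = ⌊√⌋-lower (7 ℕ.* (M ℕ.* M))

    -- Since r ≤ 3M ≤ 4M, the `∸` in `b` does not cut off at zero.
    b+r≡4M : b ℕ.+ r ≡ 4 ℕ.* M
    b+r≡4M = ℕ.m∸n+n≡m (ℕ.≤-trans (sq≤7⇒≤3* M r r²≤7M²) (ℕ.*-monoˡ-≤ M (ℕ.m≤m+n 3 1)))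

    open Truncation M r b (s≤s z≤n) b+r≡4M r²≤7M² (⌊√⌋-upper _)
      using (n≡9M; edgeCount-bound)

    ιn≡9ιM : ι n ≡ ι 9 * ι M
    ιn≡9ιM = trans (cong ι n≡9M) (ι-* 9 M)

    -- Exact, with no approximation: n = 9M clears both the 9 in τ and the denominator `M` of the
    -- truncated root.
    τₘn≡b : seq τ m * ι n ≡ ι b
    τₘn≡b = begin
      (ι 4 - s) * (+ 1 / 9) * ι n           ≡⟨ cong ((ι 4 - s) * (+ 1 / 9) *_) ιn≡9ιM ⟩
      (ι 4 - s) * (+ 1 / 9) * (ι 9 * ι M)   ≡⟨ solve 2 (λ s M → (con (ι 4) :- s) :* con (+ 1 / 9) :* (con (ι 9) :* M)
                                                  := con (ι 4) :* M :- s :* M) refl s (ι M) ⟩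
      ι 4 * ι M - s * ι M                   ≡⟨ cong₂ _-_ (sym (ι-* 4 M)) (/-*-cancel r m) ⟩
      ι (4 ℕ.* M) - ι r                     ≡⟨ cong (λ t → ι t - ι r) b+r≡4M ⟨
      ι (b ℕ.+ r) - ι r                     ≡⟨ cong (_- ι r) (ι-+ b r) ⟩
      ι b + ι r - ι r                       ≡⟨ solve 2 (λ b r → b :+ r :- r := b) refl (ι b) (ι r) ⟩
      ι b                                   ∎
      where
      open ≡-Reasoning
      open ℚ.+-*-Solver
      s = √seq 7 m

    n-pos : Positive (ι n)
    n-pos = subst Positive (cong ι (sym n≡9M)) (ℚ.normalize-pos (9 ℕ.* M) 1)

    bound : ∀ i → ι n * ι n + ι b * ι b ≤ ι 4 * ι (edgeCount a b i) + ι 9 * ι n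
    bound i = begin
      ι n * ι n + ι b * ι b      ≡⟨ cong₂ _+_ (ι-* n n) (ι-* b b) ⟨
      ι (n ℕ.* n) + ι (b ℕ.* b)  ≡⟨ ι-+ (n ℕ.* n) (b ℕ.* b) ⟨
      ι (n ℕ.* n ℕ.+ b ℕ.* b)    ≤⟨ ι-mono-≤ (edgeCount-bound i) ⟩
      ι (4 ℕ.* e ℕ.+ 9 ℕ.* n)    ≡⟨ ι-+ (4 ℕ.* e) (9 ℕ.* n) ⟩
      ι (4 ℕ.* e) + ι (9 ℕ.* n)  ≡⟨ cong₂ _+_ (ι-* 4 e) (ι-* 9 n) ⟩
      ι 4 * ι e + ι 9 * ι n      ∎
      where
      open ℚ.≤-Reasoning
      e = edgeCount a b i

    length²≡n² : ι (length (classes a b) ℕ.^ 2) ≡ ι n * ι n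
    length²≡n² = begin
      ι (length (classes a b) ℕ.^ 2)  ≡⟨ cong (λ l → ι (l ℕ.^ 2)) (length-classes a b) ⟩
      ι (n ℕ.^ 2)                     ≡⟨ cong (λ x → ι (n ℕ.* x)) (ℕ.*-identityʳ n) ⟩
      ι (n ℕ.* n)                     ≡⟨ ι-* n n ⟩
      ι n * ι n                       ∎
      where open ≡-Reasoning

    -- The graphs are fixed by `m`, whereas an inequality of reals concerns all late terms. Hence
    -- `q` is any rational close to the square of the `m`-th term of τ.
    graph-dense : ∀ i {δ q ε} → unit m ≤ δ → ∣ q - seq τ m * seq τ m ∣ < δ → δ < ε →
      ((1ℚ + q) * (+ 1 / 4) - ε) * ι (length (classes a b) ℕ.^ 2) + gap (ι n) δ < ι ∣E graph a b i ∣
    graph-dense i {δ} {q} {ε} u≤δ q≈p δ<ε =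
      -- The vertex count is the length of a list, equal to `n` only propositionally, so the bound
      -- is transported.
      subst₂ (λ W e → ((1ℚ + q) * (+ 1 / 4) - ε) * W + gap (ι n) δ < ι e)
        (sym length²≡n²) (sym (∣E∣-graph a b i))
        (edge-gap {seq τ m * seq τ m} {q} {ε} {δ} {ι n} {ι (edgeCount a b i)} n-pos dense q≈p δ<ε)
      where
      dense = ℚ.≤-trans
        (density {ι n} {ι b} {seq τ m} {ι (edgeCount a b i)} τₘn≡b (bound i))
        (ℚ.+-monoʳ-≤ (ι 4 * ι (edgeCount a b i))
          (9N≤δN² {unit m} {ι M} {ι n} {δ} n-pos (/-*-cancel 1 m) ιn≡9ιM u≤δ))

open Estimates

-- Passage to Cauchy reals

open import Defs using (_+_; _*_; _-_; _<_; _÷_)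

-- The moduli are arguments, so that their bodies, which are huge for τ * τ, stay folded.
dense-graphs : ∀ ε δ N → 0ℚ ℚ.< δ →
  (∀ k → N ℕ.≤ k → 0ℚ ℚ.+ δ ℚ.< seq ε k) →
  ∃[ K ] (∀ k m → K ℕ.≤ k → K ℕ.≤ m → ∣ seq (τ * τ) k ℚ.- seq (τ * τ) m ∣ ℚ.< δ) →
  ∃[ L ] (∀ m → L ℕ.≤ m → unit m ℚ.≤ δ) →
  ∃[ n ] (0 ℕ.< n ×
  Σ[ G ∈ (Fin 3 → Graph n) ]
  (¬ RainbowTriangle G ×
  (∀ i → ((fromℕ 1 + τ * τ) ÷ 4 - ε) * fromℕ (n ℕ.^ 2) < fromℕ ∣E G i ∣)))
dense-graphs ε δ N δ>0 δ<ε (K , close) (L , small) =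
  length (classes a b) , subst (0 ℕ.<_) (sym (length-classes a b)) (s≤s z≤n) ,
  graph a b , graph-rainbow-free a b ,
  λ i → gap (ι n) δ , gap>0 {ι n} {δ} n-pos δ>0 , N ℕ.⊔ K , λ k N⊔K≤k →
    graph-dense i {δ} {seq (τ * τ) k} {seq ε k} (small m (ℕ.m≤n⊔m K L))
      (close k m (ℕ.m⊔n≤o⇒n≤o N K N⊔K≤k) (ℕ.m≤m⊔n K L))
      (subst (ℚ._< seq ε k) (ℚ.+-identityˡ δ) (δ<ε k (ℕ.m⊔n≤o⇒m≤o N K N⊔K≤k)))
  where
  -- From `K` on, terms of τ² differ by less than `δ`; from `L` on, 1/(m+1) is at most `δ`.
  m = K ℕ.⊔ L
  open Construction m

mainTheorem2 : ∀ (ε : ℝ) → fromℕ 0 < ε →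
    ∃[ n ] (0 ℕ.< n ×
    Σ[ G ∈ (Fin 3 → Graph n) ]
    (¬ RainbowTriangle G ×
    (∀ i → ((fromℕ 1 + τ * τ) ÷ 4 - ε) * fromℕ (n ℕ.^ 2) < fromℕ ∣E G i ∣)))
-- The rational gap witnessing that `ε` is positive also serves as tolerance for τ² and for the
-- linear error.
mainTheorem2 ε (δ , δ>0 , N , δ<ε) =
  dense-graphs ε δ N δ>0 δ<ε (cauchy (τ * τ) δ δ>0) (unit≤ δ δ>0)
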